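{- The following statements are equivalent for every graph $G$: (i) $G$ is paw-pivot-minor-free. (ii) $G$ is diamond-pivot-minor-free. (iii) $G$ has no induced subgraph isomorphic to the paw, the diamond, or an odd cycle of length at least $5$. (iv) Every connected component of $G$ is either bipartite or complete.
   Context: Graphs are finite, without loops or multiple edges. The paw is the graph obtained from a triangle by adding one vertex adjacent to exactly one vertex of the triangle; the diamond is $K_4$ minus one edge. For a vertex $u$ of a graph $G$, the local complementation $G*u$ is obtained from $G$ by complementing the adjacency between every pair of distinct neighbours of $u$. For an edge $uv$ of $G$, the edge pivot is $G\wedge uv=((G*u)*v)*u$. A graph $G$ contains $H$ as a pivot-minor if $H$ can be obtained from $G$ by a sequence of vertex deletions and edge pivots; $G$ is $H$-pivot-minor-free if it contains no pivot-minor isomorphic to $H$. -}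

module Defs where

open import Data.Bool.Base using (Bool; false; T; not; _∧_; _∨_; _xor_)
open import Data.Bool.Properties using (∧-comm; ∧-zeroʳ; ∨-comm)
open import Data.Fin.Base using (Fin; toℕ; punchIn)
open import Data.Fin.Patterns using (0F; 1F; 2F; 3F)
open import Data.Fin.Properties using (_≟_; punchIn-injective)
open import Data.List.Base using (List; []; _∷_)
import Data.List.Membership.DecPropositional as DecMembership
open import Data.Nat.Base using (ℕ; suc; _≡ᵇ_)
open import Data.Product.Base using (Σ; ∃; _×_; _,_)
open import Data.Product.Properties using (≡-dec)
open import Function.Bundles using (_↣_; _↔_; _⇔_; mk↣; module Injection; module Inverse)
open import Relation.Binary.Construct.Closure.ReflexiveTransitive using (Star)
open import Relation.Binary.PropositionalEquality
  using (_≡_; _≢_; refl; sym; cong; cong₂; ≢-sym)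
open import Relation.Nullary.Decidable using (does; yes; no; dec-true; dec-false)
open import Relation.Nullary.Negation using (¬_)

-- Finite simple graphs with vertex set Fin n.
record Graph (n : ℕ) : Set where
  field
    adj        : Fin n → Fin n → Bool
    adj-sym    : ∀ x y → adj x y ≡ adj y x
    adj-irrefl : ∀ x → adj x x ≡ false

  Edge : Fin n → Fin n → Set
  Edge x y = T (adj x y)

  Connected : Fin n → Fin n → Set
  Connected = Star Edge

open Graph public

distinct : ∀ {n} → Fin n → Fin n → Bool
distinct x y = not (does (x ≟ y))

distinct-sym : ∀ {n} (x y : Fin n) → distinct x y ≡ distinct y x
distinct-sym x y with x ≟ y
... | yes x≡y = sym (cong not (dec-true (y ≟ x) (sym x≡y)))
... | no  x≢y = sym (cong not (dec-false (y ≟ x) (≢-sym x≢y)))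

distinct-irrefl : ∀ {n} (x : Fin n) → distinct x x ≡ false
distinct-irrefl x = cong not (dec-true (x ≟ x) refl)

record _≅_ {m n : ℕ} (G : Graph m) (H : Graph n) : Set where
  field
    bijection : Fin m ↔ Fin n
    preserves : ∀ x y → adj G x y ≡
                adj H (Inverse.to bijection x) (Inverse.to bijection y)

-- The induced subgraph on the image of s; a vertex subset of size m is
-- given by an injective enumeration, which relabels its elements as Fin m.
_[_] : ∀ {m n} → Graph n → Fin m ↣ Fin n → Graph m
adj        (G [ s ]) x y = adj G (Injection.to s x) (Injection.to s y)
adj-sym    (G [ s ]) x y = adj-sym G (Injection.to s x) (Injection.to s y)
adj-irrefl (G [ s ]) x   = adj-irrefl G (Injection.to s x)

HasInduced : ∀ {k n} → Graph k → Graph n → Set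
HasInduced {n = n} H G = ∃ λ m → Σ (Fin m ↣ Fin n) λ s → (G [ s ]) ≅ H

deleteVertex : ∀ {n} → Graph (suc n) → Fin (suc n) → Graph n
deleteVertex G v = G [ mk↣ (λ {x} {y} → punchIn-injective v x y) ]

infixl 7 _*_

_*_ : ∀ {n} → Graph n → Fin n → Graph n
adj (G * u) x y = adj G x y xor ((adj G u x ∧ adj G u y) ∧ distinct x y)
adj-sym (G * u) x y =
  cong₂ _xor_ (adj-sym G x y)
    (cong₂ _∧_ (∧-comm (adj G u x) (adj G u y)) (distinct-sym x y))
adj-irrefl (G * u) x
  rewrite distinct-irrefl x | ∧-zeroʳ (adj G u x ∧ adj G u x) | adj-irrefl G x
  = refl

-- Meaningful only when uv is an edge, which is demanded where it is used.
pivot : ∀ {n} → Graph n → Fin n → Fin n → Graph n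
pivot G u v = G * u * v * u

data _⟶_ : ∃ Graph → ∃ Graph → Set where
  delete    : ∀ {n} (G : Graph (suc n)) (v : Fin (suc n)) →
              (suc n , G) ⟶ (n , deleteVertex G v)
  pivotEdge : ∀ {n} (G : Graph n) (u v : Fin n) → Edge G u v →
              (n , G) ⟶ (n , pivot G u v)

PivotMinorFree : ∀ {k n} → Graph k → Graph n → Set
PivotMinorFree H G =
  ¬ (∃ λ m → Σ (Graph m) λ H′ → Star _⟶_ (_ , G) (m , H′) × H′ ≅ H)

-- The irreflexive symmetrisation of r.
fromRel : ∀ {n} → (Fin n → Fin n → Bool) → Graph n
adj        (fromRel r) x y = distinct x y ∧ (r x y ∨ r y x)
adj-sym    (fromRel r) x y =
  cong₂ _∧_ (distinct-sym x y) (∨-comm (r x y) (r y x))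
adj-irrefl (fromRel r) x   = cong (_∧ (r x x ∨ r x x)) (distinct-irrefl x)

fromEdges : ∀ {n} → List (Fin n × Fin n) → Graph n
fromEdges es = fromRel λ x y → does ((x , y) ∈? es)
  where open DecMembership (≡-dec _≟_ _≟_) using (_∈?_)

paw : Graph 4
paw = fromEdges ((0F , 1F) ∷ (0F , 2F) ∷ (1F , 2F) ∷ (2F , 3F) ∷ [])

diamond : Graph 4
diamond = fromEdges ((0F , 1F) ∷ (0F , 2F) ∷ (1F , 2F) ∷ (1F , 3F) ∷ (2F , 3F) ∷ [])

-- Edges i(i+1) and (k-1)0; this is the cycle of length k for k ≥ 3.
cycle : (k : ℕ) → Graph k
cycle k = fromRel λ i j →
  (suc (toℕ i) ≡ᵇ toℕ j) ∨ ((suc (toℕ i) ≡ᵇ k) ∧ (toℕ j ≡ᵇ 0))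

-- The image of s is the connected component of some vertex.
IsComponent : ∀ {m n} → Graph n → Fin m ↣ Fin n → Set
IsComponent G s =
  ∃ λ v → ∀ x → (∃ λ i → Injection.to s i ≡ x) ⇔ Connected G v x

Bipartite : ∀ {n} → Graph n → Set
Bipartite {n} G =
  Σ (Fin n → Bool) λ side → ∀ x y → Edge G x y → side x ≢ side y

Complete : ∀ {n} → Graph n → Set
Complete G = ∀ x y → x ≢ y → Edge G x y

{-# OPTIONS --safe #-}
-- Pivoting turns the paw and the diamond into each other, and pivoting an edge of a
-- cycle of length k + 2 and deleting its ends gives the cycle of length k, while the
-- cycle of length 5 pivots to a graph containing the paw.  Without induced paws and
-- diamonds, a vertex adjacent to one vertex of a triangle is adjacent to all of it, so
-- components with a triangle are complete; the other components have no odd closed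
-- walk, because a shortest one would be an induced odd cycle.  Finally, having only
-- bipartite or complete components is inherited by induced subgraphs and pivots
-- (a pivot in a complete component does nothing, and in a bipartite component it
-- exchanges the sides of the two ends), and the paw does not have this property.
module Submission where

open import Defs
open import Data.Bool.Base using (Bool; true; false; T; not; _∧_; _∨_; _xor_)
open import Data.Bool.Properties using (T?; T-≡; T-∧; T-∨; not-¬; ∧-zeroʳ; xor-same)
import Data.Bool.Properties as Bool
open import Data.Bool.Solver using (module xor-∧-Solver)
open import Data.Empty using (⊥; ⊥-elim)
open import Data.Fin.Base as Fin using (Fin; zero; suc; toℕ; fromℕ; inject₁; punchIn; punchOut)
open import Data.Fin.Induction using (<-weakInduction)
open import Data.Fin.Patterns using (0F; 1F; 2F; 3F; 4F)
open import Data.Fin.Properties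
  using (_≟_; any?; all?; <-cmp; sequence; suc-injective; toℕ<n; toℕ-inject₁; toℕ-fromℕ;
         punchOut-injective; punchIn-injective; punchIn-punchOut)
open import Data.Maybe.Base as Maybe using (Maybe; just; nothing; fromMaybe)
open import Data.Nat.Base as ℕ using (ℕ; zero; suc; _+_; _≤_; _<_; z≤n; s≤s; s<s; _≡ᵇ_)
open import Data.Nat.Divisibility using (_∣_; _∤_; divides; ∣m∣n⇒∣m+n; ∣-refl)
open import Data.Nat.Induction using (<-wellFounded)
import Data.Nat.Properties as ℕ
open import Data.Product.Base using (Σ; ∃; _×_; _,_; proj₁; proj₂)
open import Data.Sum.Base using (_⊎_; inj₁; inj₂; swap; map₁)
open import Data.Vec.Base using ([]; _∷_; lookup)
open import Effect.Monad using (RawMonad)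
open import Function.Base using (_∘_; id)
open import Function.Bundles
  using (_↣_; _⇔_; mk↣; mk⇔; mk↔ₛ′; module Injection; module Inverse; module Equivalence)
open import Induction.WellFounded using (Acc; acc)
open import Relation.Binary.Construct.Closure.ReflexiveTransitive
  using (Star; ε; _◅_; _◅◅_; gmap; reverse)
open import Relation.Binary.Definitions using (tri<; tri≈; tri>)
open import Relation.Binary.PropositionalEquality
  using (_≡_; _≢_; refl; sym; trans; cong; cong₂; subst; subst₂; ≢-sym; module ≡-Reasoning)
open import Relation.Nullary.Decidable
  using (Dec; yes; no; _×-dec_; _⊎-dec_; _→-dec_; ¬?; dec-false; from-yes; ¬¬-excluded-middle)
open import Relation.Nullary.Negation using (¬_; contradiction; ¬¬-Monad)

open Equivalence using () renaming (to to ⇒; from to ⇐)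

-- Booleans and edges.

T-ext : ∀ {a b} → (T a → T b) → (T b → T a) → a ≡ b
T-ext {false} {false} f g = refl
T-ext {false} {true}  f g = ⊥-elim (g _)
T-ext {true}  {false} f g = ⊥-elim (f _)
T-ext {true}  {true}  f g = refl

¬T⇒false : ∀ {a} → ¬ T a → a ≡ false
¬T⇒false {false} _  = refl
¬T⇒false {true}  ¬t = ⊥-elim (¬t _)

≢⇒distinct : ∀ {n} {x y : Fin n} → x ≢ y → distinct x y ≡ true
≢⇒distinct x≢y = cong not (dec-false (_ ≟ _) x≢y)

flip : ∀ {n} (G : Graph n) {x y} → Edge G x y → Edge G y x
flip G {x} {y} = subst T (adj-sym G x y)

Edge⇒≢ : ∀ {n} (G : Graph n) {x y} → Edge G x y → x ≢ y
Edge⇒≢ G {x} e refl = subst T (adj-irrefl G x) e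

-- Embeddings of induced subgraphs

record _↪_ {m n : ℕ} (H : Graph m) (G : Graph n) : Set where
  constructor embedding
  field
    to        : Fin m → Fin n
    injective : ∀ {x y} → to x ≡ to y → x ≡ y
    preserves : ∀ x y → adj H x y ≡ adj G (to x) (to y)

  Edge⁺ : ∀ {x y} → Edge H x y → Edge G (to x) (to y)
  Edge⁺ {x} {y} = subst T (preserves x y)

  Edge⁻ : ∀ {x y} → Edge G (to x) (to y) → Edge H x y
  Edge⁻ {x} {y} = subst T (sym (preserves x y))

open _↪_ using (to; injective; preserves; Edge⁺; Edge⁻)

↪-trans : ∀ {k m n} {F : Graph k} {H : Graph m} {G : Graph n} → F ↪ H → H ↪ G → F ↪ G
↪-trans f g = embedding (to g ∘ to f) (injective f ∘ injective g)
  λ x y → trans (preserves f x y) (preserves g (to f x) (to f y))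

↪-fromIncreasing : ∀ {m n} {H : Graph m} {G : Graph n} (f : Fin m → Fin n) →
  (∀ {x y} → x Fin.< y → f x ≢ f y) →
  (∀ {x y} → x Fin.< y → adj H x y ≡ adj G (f x) (f y)) → H ↪ G
↪-fromIncreasing {H = H} {G} f separates agrees = embedding f inj pres
  where
  inj : ∀ {x y} → f x ≡ f y → x ≡ y
  inj {x} {y} fx≡fy with <-cmp x y
  ... | tri< x<y _ _ = contradiction fx≡fy (separates x<y)
  ... | tri≈ _ x≡y _ = x≡y
  ... | tri> _ _ y<x = contradiction (sym fx≡fy) (separates y<x)

  pres : ∀ x y → adj H x y ≡ adj G (f x) (f y)
  pres x y with <-cmp x y
  ... | tri< x<y _ _  = agrees x<y
  ... | tri≈ _ refl _ = trans (adj-irrefl H x) (sym (adj-irrefl G (f x)))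
  ... | tri> _ _ y<x  = trans (adj-sym H x y) (trans (agrees y<x) (adj-sym G (f y) (f x)))

[]-↪ : ∀ {m n} (G : Graph n) (s : Fin m ↣ Fin n) → (G [ s ]) ↪ G
[]-↪ G s = embedding (Injection.to s) (Injection.injective s) λ _ _ → refl

deleteVertex-↪ : ∀ {n} (G : Graph (suc n)) v → deleteVertex G v ↪ G
deleteVertex-↪ G v = embedding (punchIn v) (punchIn-injective v _ _) λ _ _ → refl

≅⇒↪ : ∀ {m n} {G : Graph m} {H : Graph n} → G ≅ H → H ↪ G
≅⇒↪ {G = G} {H} iso = embedding from (λ p → trans (sym (to∘from _)) (trans (cong into p) (to∘from _)))
  λ x y → trans (cong₂ (adj H) (sym (to∘from x)) (sym (to∘from y)))
                (sym (_≅_.preserves iso (from x) (from y)))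
  where
  open Inverse (_≅_.bijection iso) using (from) renaming (to to into)
  to∘from : ∀ x → into (from x) ≡ x
  to∘from = Inverse.strictlyInverseˡ (_≅_.bijection iso)

HasInduced⇒↪ : ∀ {k n} {H : Graph k} {G : Graph n} → HasInduced H G → H ↪ G
HasInduced⇒↪ {G = G} (_ , s , iso) = ↪-trans (≅⇒↪ iso) ([]-↪ G s)

↪⇒HasInduced : ∀ {k n} {H : Graph k} {G : Graph n} → H ↪ G → HasInduced H G
↪⇒HasInduced f = _ , mk↣ (injective f) ,
  record { bijection = mk↔ₛ′ id id (λ _ → refl) λ _ → refl
         ; preserves = λ x y → sym (preserves f x y) }

-- Pivot-minors

-- Ending in an embedding rather than an isomorphism postpones the vertex deletions that isolate
-- `H`; `↪⇒minor` carries them out.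
_PivotMinorOf_ : ∀ {k n} → Graph k → Graph n → Set
H PivotMinorOf G = ∃ λ m → Σ (Graph m) λ G′ → Star _⟶_ (_ , G) (m , G′) × H ↪ G′

↪⇒minor : ∀ {k n} {H : Graph k} {G : Graph n} → H ↪ G →
  ∃ λ m → Σ (Graph m) λ G′ → Star _⟶_ (_ , G) (m , G′) × G′ ≅ H
↪⇒minor {k} {zero} {H} {G} f = _ , G , ε ,
  record { bijection = mk↔ₛ′ (λ ()) (to f) (λ x → absurd (to f x)) λ () ; preserves = λ () }
  where
  absurd : ∀ {A : Set} → Fin 0 → A
  absurd ()
↪⇒minor {k} {suc n} {H} {G} f with any? (λ v → ¬? (any? λ x → to f x ≟ v))
... | yes (v , missed) = let m , G′ , steps , iso = ↪⇒minor f′ in m , G′ , delete G v ◅ steps , iso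
  where
  v≢ : ∀ x → v ≢ to f x
  v≢ x v≡ = missed (x , sym v≡)
  f′ : H ↪ deleteVertex G v
  f′ = embedding (λ x → punchOut (v≢ x)) (λ p → injective f (punchOut-injective (v≢ _) (v≢ _) p))
    λ x y → trans (preserves f x y)
      (sym (cong₂ (adj G) (punchIn-punchOut (v≢ x)) (punchIn-punchOut (v≢ y))))
... | no none = _ , G , ε , record
  { bijection = mk↔ₛ′ preimage (to f) (λ x → injective f (to∘preimage (to f x))) to∘preimage
  ; preserves = λ x y → trans (sym (cong₂ (adj G) (to∘preimage x) (to∘preimage y)))
                              (sym (preserves f (preimage x) (preimage y))) }
  where
  hit : ∀ v → ∃ λ x → to f x ≡ v
  hit v with any? (λ x → to f x ≟ v)
  ... | yes p = p
  ... | no ¬p = contradiction (v , ¬p) none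
  preimage : Fin (suc n) → Fin k
  preimage v = proj₁ (hit v)
  to∘preimage : ∀ v → to f (preimage v) ≡ v
  to∘preimage v = proj₂ (hit v)

PivotMinorFree⇒ : ∀ {k n} {H : Graph k} {G : Graph n} → PivotMinorFree H G → ¬ (H PivotMinorOf G)
PivotMinorFree⇒ free (_ , _ , steps , f) =
  let m , G″ , steps′ , iso = ↪⇒minor f in free (m , G″ , steps ◅◅ steps′ , iso)

PivotMinorFree⇐ : ∀ {k n} {H : Graph k} {G : Graph n} → ¬ (H PivotMinorOf G) → PivotMinorFree H G
PivotMinorFree⇐ ¬minor (m , G′ , steps , iso) = ¬minor (m , G′ , steps , ≅⇒↪ iso)

-- Whether a pair is complemented depends only on its distinctness and its adjacencies to `u`, so
-- the operation commutes with restriction to an induced subgraph containing `u`.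
*-↪ : ∀ {m n} {H : Graph m} {G : Graph n} (f : H ↪ G) u → (H * u) ↪ (G * to f u)
*-↪ {H = H} {G} f u = embedding (to f) (injective f) λ x y →
  cong₂ _xor_ (preserves f x y)
    (cong₂ _∧_ (cong₂ _∧_ (preserves f u x) (preserves f u y)) (distinct⁺ x y))
  where
  distinct⁺ : ∀ x y → distinct x y ≡ distinct (to f x) (to f y)
  distinct⁺ x y with x ≟ y
  ... | yes refl = sym (distinct-irrefl (to f x))
  ... | no x≢y   = sym (≢⇒distinct (x≢y ∘ injective f))

pivot-↪ : ∀ {m n} {H : Graph m} {G : Graph n} (f : H ↪ G) u v →
  pivot H u v ↪ pivot G (to f u) (to f v)
pivot-↪ f u v = *-↪ (*-↪ (*-↪ f u) v) u

-- The pivot is performed in the host at the image of `uv`, so a pivot computed once in the pattern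
-- serves for every `G`.
minor-pivot : ∀ {j k n} {F : Graph j} {H : Graph k} {G : Graph n} u v → Edge H u v →
  F ↪ pivot H u v → H PivotMinorOf G → F PivotMinorOf G
minor-pivot u v uv f (m , G′ , steps , g) =
  m , _ , steps ◅◅ (pivotEdge G′ (to g u) (to g v) (Edge⁺ g uv) ◅ ε) , ↪-trans f (pivot-↪ g u v)

-- Explicit pivots of small graphs.

Embeds? : ∀ {m n} (H : Graph m) (G : Graph n) (f : Fin m → Fin n) →
  Dec ((∀ x y → f x ≡ f y → x ≡ y) × (∀ x y → adj H x y ≡ adj G (f x) (f y)))
Embeds? H G f =
  (all? λ x → all? λ y → (f x ≟ f y) →-dec (x ≟ y))
  ×-dec (all? λ x → all? λ y → adj H x y Bool.≟ adj G (f x) (f y))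

fromInspection : ∀ {m n} {H : Graph m} {G : Graph n} {f : Fin m → Fin n} →
  (∀ x y → f x ≡ f y → x ≡ y) × (∀ x y → adj H x y ≡ adj G (f x) (f y)) → H ↪ G
fromInspection {f = f} (inj , pres) = embedding f (inj _ _) pres

-- The ends `0F` and `2F` exchange their other neighbours and `1F`, `3F` become adjacent, which
-- leaves `2F`, `3F` as the only non-adjacent pair.
diamond↪pivot-paw : diamond ↪ pivot paw 0F 2F
diamond↪pivot-paw = fromInspection (from-yes (Embeds? diamond (pivot paw 0F 2F) σ))
  where
  σ : Fin 4 → Fin 4
  σ 0F = 2F
  σ 1F = 0F
  σ 2F = 1F
  σ 3F = 3F

-- The edge between `2F` and `3F` disappears and `3F` moves from `1F` to `0F`, where it hangs from
-- the triangle.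
paw↪pivot-diamond : paw ↪ pivot diamond 1F 0F
paw↪pivot-diamond = fromInspection (from-yes (Embeds? paw (pivot diamond 1F 0F) σ))
  where
  σ : Fin 4 → Fin 4
  σ 0F = 1F
  σ 1F = 2F
  σ 2F = 0F
  σ 3F = 3F

-- The new edge between `2F` and `4F` closes a triangle with `3F`, and `0F` now hangs from `2F`;
-- `1F` is left out.
paw↪pivot-cycle₅ : paw ↪ pivot (cycle 5) 0F 1F
paw↪pivot-cycle₅ = fromInspection (from-yes (Embeds? paw (pivot (cycle 5) 0F 1F) σ))
  where
  σ : Fin 4 → Fin 5
  σ 0F = 3F
  σ 1F = 4F
  σ 2F = 2F
  σ 3F = 0F

-- Adjacency after a pivot.

module _ {n} (G : Graph n) {u v : Fin n} (uv : Edge G u v) where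
  private
    uv≡true : adj G u v ≡ true
    uv≡true = ⇒ T-≡ uv

    vu≡true : adj G v u ≡ true
    vu≡true = ⇒ T-≡ (flip G uv)

  pivot-ends : adj (pivot G u v) u v ≡ true
  pivot-ends rewrite adj-irrefl G u | adj-irrefl G v | uv≡true | vu≡true
    | distinct-irrefl u | distinct-irrefl v = refl

  pivot-first : ∀ {y} → y ≢ u → y ≢ v → adj (pivot G u v) u y ≡ adj G v y
  pivot-first {y} y≢u y≢v rewrite adj-irrefl G u | distinct-irrefl u | uv≡true | vu≡true
    | ≢⇒distinct (≢-sym y≢u) | ≢⇒distinct (≢-sym y≢v) with adj G u y | adj G v y
  ... | false | false = refl
  ... | false | true  = refl
  ... | true  | false = refl
  ... | true  | true  = refl

  pivot-second : ∀ {y} → y ≢ u → y ≢ v → adj (pivot G u v) v y ≡ adj G u y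
  pivot-second {y} y≢u y≢v rewrite adj-irrefl G u | distinct-irrefl v | adj-irrefl G v | uv≡true | vu≡true
    | ≢⇒distinct (≢-sym y≢u) | ≢⇒distinct (≢-sym y≢v)
    with adj G u y | adj G v y
  ... | false | false = refl
  ... | false | true  = refl
  ... | true  | false = refl
  ... | true  | true  = refl

  -- The added term is the determinant over the field with two elements of the adjacency vectors of
  -- `x` and `y` to `u` and `v`. It is nonzero exactly when both vectors are nonzero and distinct:
  -- the pivot complements between the vertices seeing only `u`, only `v`, and both.
  pivot-rest : ∀ {x y} → x ≢ u → x ≢ v → y ≢ u → y ≢ v → x ≢ y →
    adj (pivot G u v) x y ≡
      adj G x y xor ((adj G u x ∧ adj G v y) xor (adj G v x ∧ adj G u y))
  pivot-rest {x} {y} x≢u x≢v y≢u y≢v x≢y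
    rewrite adj-irrefl G u | uv≡true | vu≡true | ≢⇒distinct x≢y
    | ≢⇒distinct (≢-sym x≢u) | ≢⇒distinct (≢-sym x≢v)
    | ≢⇒distinct (≢-sym y≢u) | ≢⇒distinct (≢-sym y≢v) =
    -- Each of the three complementations adds one product of current adjacencies; after expansion
    -- only the cross terms remain.
    solve 5 (λ a p q r s →
        ((a :+ (p :* r) :* con true) :+ ((q :+ p :* con true) :* (s :+ r :* con true)) :* con true)
          :+ ((p :+ con false :+ (q :+ p :* con true) :* con true)
              :* (r :+ con false :+ (s :+ r :* con true) :* con true)) :* con true
        := a :+ (p :* s :+ q :* r))
      refl (adj G x y) (adj G u x) (adj G v x) (adj G u y) (adj G v y)
    where open xor-∧-Solver

-- Pivots of cycles.

-- Apart from each other, `0F` sees only the last vertex and `1F` sees only `2F`. The pivot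
-- therefore joins these two, closing the remaining path into a cycle.
cycle↪pivot-cycle : ∀ k → cycle (3 + k) ↪ pivot (cycle (5 + k)) 0F 1F
cycle↪pivot-cycle k = ↪-fromIncreasing f (λ { x<y refl → ℕ.<-irrefl refl x<y })
  λ {x} {y} x<y → trans (agrees x y x<y) (sym (pivoted x<y))
  where
  C = cycle (5 + k)

  f : Fin (3 + k) → Fin (5 + k)
  f x = suc (suc x)

  pivoted : ∀ {x y} → x Fin.< y → adj (pivot C 0F 1F) (f x) (f y) ≡
    adj C (f x) (f y) xor ((adj C 0F (f x) ∧ adj C 1F (f y)) xor (adj C 1F (f x) ∧ adj C 0F (f y)))
  pivoted {x} {y} x<y = pivot-rest C {0F} {1F} _ {f x} {f y} 
    (λ ()) (λ ()) (λ ()) (λ ()) λ { refl → ℕ.<-irrefl refl x<y }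

  agrees : ∀ x y → x Fin.< y → adj (cycle (3 + k)) x y ≡
    adj C (f x) (f y) xor ((adj C 0F (f x) ∧ adj C 1F (f y)) xor (adj C 1F (f x) ∧ adj C 0F (f y)))
  agrees zero    (suc zero)    _   = refl
  -- The test asks whether `y` denotes the last vertex, where the new closing edge appears.
  agrees zero    (suc (suc y)) _   with toℕ y ≡ᵇ k
  ... | false = refl
  ... | true  = refl
  -- Neither vertex is adjacent to `1F` in the long cycle, so both correction products vanish.
  agrees (suc x) (suc y)       x<y
    rewrite ∧-zeroʳ (toℕ x ≡ᵇ suc k) | ∧-zeroʳ (toℕ y ≡ᵇ suc k) with toℕ x ≡ᵇ suc k
  ... | false = sym (Bool.xor-identityʳ _)
  ... | true  = sym (Bool.xor-identityʳ _)

-- The descent by two preserves parity, so it ends at length five; length six is excluded as even.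
paw-minor-cycle : ∀ {n} {G : Graph n} k → 2 ∤ 5 + k → cycle (5 + k) PivotMinorOf G → paw PivotMinorOf G
paw-minor-cycle zero          _   C = minor-pivot 0F 1F _ paw↪pivot-cycle₅ C
paw-minor-cycle (suc zero)    odd _ = contradiction (divides 3 refl) odd
paw-minor-cycle (suc (suc k)) odd C =
  paw-minor-cycle k (odd ∘ ∣m∣n⇒∣m+n ∣-refl) (minor-pivot 0F 1F _ (cycle↪pivot-cycle (2 + k)) C)

-- A local form of the component condition, and its invariance.

-- kind x is nothing if the component of x is complete, and otherwise the side
-- of x in a bipartition; both conditions are local.
record Classified {n} (G : Graph n) : Set where
  constructor classified
  field
    kind       : Fin n → Maybe Bool
    alternates : ∀ {x y} → Edge G x y → kind y ≡ Maybe.map not (kind x)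
    closes     : ∀ {x y z} → kind y ≡ nothing → Edge G x y → Edge G y z → x ≢ z → Edge G x z

  nothing⁺ : ∀ {x y} → Edge G x y → kind x ≡ nothing → kind y ≡ nothing
  nothing⁺ e p = trans (alternates e) (cong (Maybe.map not) p)

Classified-↪ : ∀ {m n} {H : Graph m} {G : Graph n} → H ↪ G → Classified G → Classified H
Classified-↪ f (classified kind alternates closes) = classified (kind ∘ to f) (alternates ∘ Edge⁺ f)
  λ p e e′ x≢z → Edge⁻ f (closes p (Edge⁺ f e) (Edge⁺ f e′) (x≢z ∘ injective f))

module _ {n} {G : Graph n} (class : Classified G) {u v : Fin n} (uv : Edge G u v) where
  open Classified class
  private
    G∧uv = pivot G u v

    vu : Edge G v u
    vu = flip G uv

    kind′ : Fin n → Maybe Bool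
    kind′ x with x ≟ u | x ≟ v
    ... | yes _ | _     = kind v
    ... | no _  | yes _ = kind u
    ... | no _  | no _  = kind x

    kind′-u : kind′ u ≡ kind v
    kind′-u with u ≟ u | u ≟ v
    ... | yes _  | _ = refl
    ... | no u≢u | _ = contradiction refl u≢u

    kind′-v : kind′ v ≡ kind u
    kind′-v with v ≟ u | v ≟ v
    ... | yes v≡u | _      = contradiction (sym v≡u) (Edge⇒≢ G uv)
    ... | no _    | yes _  = refl
    ... | no _    | no v≢v = contradiction refl v≢v

    kind′-rest : ∀ {x} → x ≢ u → x ≢ v → kind′ x ≡ kind x
    kind′-rest {x} x≢u x≢v with x ≟ u | x ≟ v
    ... | yes x≡u | _       = contradiction x≡u x≢u
    ... | no _    | yes x≡v = contradiction x≡v x≢v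
    ... | no _    | no _    = refl

    kind′-nothing : ∀ {x} → kind′ x ≡ nothing → kind x ≡ nothing
    kind′-nothing {x} p with x ≟ u | x ≟ v
    ... | yes refl | _        = nothing⁺ vu p
    ... | no _     | yes refl = nothing⁺ uv p
    ... | no _     | no _     = p

    -- The cases follow the formulas for the pivot, according to how a pair meets the ends; symmetry
    -- removes the mirrored ones.
    pairs : (P : Fin n → Fin n → Set) → (∀ {x y} → P x y → P y x) → (∀ x → P x x) → P u v →
      (∀ {y} → y ≢ u → y ≢ v → P u y) → (∀ {y} → y ≢ u → y ≢ v → P v y) →
      (∀ {x y} → x ≢ u → x ≢ v → y ≢ u → y ≢ v → x ≢ y → P x y) → ∀ x y → P x y
    pairs P P-sym diagonal ends first second rest x y with x ≟ u | x ≟ v | y ≟ u | y ≟ v | x ≟ y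
    ... | _        | _        | _        | _        | yes refl = diagonal x
    ... | yes refl | _        | yes refl | _        | no x≢y   = contradiction refl x≢y
    ... | yes refl | _        | no _     | yes refl | _        = ends
    ... | yes refl | _        | no y≢u   | no y≢v   | _        = first y≢u y≢v
    ... | no _     | yes refl | yes refl | _        | _        = P-sym ends
    ... | no _     | yes refl | no y≢u   | yes refl | no x≢y   = contradiction refl x≢y
    ... | no _     | yes refl | no y≢u   | no y≢v   | _        = second y≢u y≢v
    ... | no x≢u   | no x≢v   | yes refl | _        | _        = P-sym (first x≢u x≢v)
    ... | no x≢u   | no x≢v   | no _     | yes refl | _        = P-sym (second x≢u x≢v)
    ... | no x≢u   | no x≢v   | no y≢u   | no y≢v   | no x≢y   = rest x≢u x≢v y≢u y≢v x≢y

    map-not-swap : ∀ {a b} → b ≡ Maybe.map not a → a ≡ Maybe.map not b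
    map-not-swap {nothing}    refl = refl
    map-not-swap {just false} refl = refl
    map-not-swap {just true}  refl = refl

    -- At an end, the exchange in `kind′` compensates for the exchange of neighbourhoods. Any other
    -- edge of the pivot is either old or produced by one of the two products, which `sources` tells
    -- apart.
    alternates′ : ∀ x y → Edge G∧uv x y → kind′ y ≡ Maybe.map not (kind′ x)
    alternates′ = pairs _
      (λ {x} {y} P e → map-not-swap (P (flip G∧uv e)))
      (λ x e → ⊥-elim (Edge⇒≢ G∧uv e refl))
      (λ _ → subst₂ Alternate (sym kind′-u) (sym kind′-v) (alternates vu))
      (λ y≢u y≢v e → subst₂ Alternate (sym kind′-u) (sym (kind′-rest y≢u y≢v))
        (alternates (subst T (pivot-first G uv y≢u y≢v) e)))
      (λ y≢u y≢v e → subst₂ Alternate (sym kind′-v) (sym (kind′-rest y≢u y≢v))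
        (alternates (subst T (pivot-second G uv y≢u y≢v) e)))
      λ {x} {y} x≢u x≢v y≢u y≢v x≢y e →
        subst₂ Alternate (sym (kind′-rest x≢u x≢v)) (sym (kind′-rest y≢u y≢v))
          (changed (sources _ (⇒ T-≡ (subst T (pivot-rest G uv x≢u x≢v y≢u y≢v x≢y) e))))
      where
      Alternate : Maybe Bool → Maybe Bool → Set
      Alternate a b = b ≡ Maybe.map not a

      sources : ∀ a {p q r s} → a xor ((p ∧ q) xor (r ∧ s)) ≡ true → T a ⊎ (T p × T q) ⊎ (T r × T s)
      sources true  _ = inj₁ _
      sources false {true} {true} _ = inj₂ (inj₁ _)
      sources false {true} {false} {true} {true} _ = inj₂ (inj₂ _)
      sources false {false} {_} {true} {true} _ = inj₂ (inj₂ _)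

      -- If x and y are neighbours of different ends of uv, then x u v y is a path.
      changed : ∀ {x y} → Edge G x y ⊎ (Edge G u x × Edge G v y) ⊎ (Edge G v x × Edge G u y) →
        Alternate (kind x) (kind y)
      changed (inj₁ xy)               = alternates xy
      changed (inj₂ (inj₁ (ux , vy))) =
        trans (alternates vy) (cong (Maybe.map not) (trans (alternates uv) (sym (alternates ux))))
      changed (inj₂ (inj₂ (vx , uy))) =
        trans (alternates uy) (cong (Maybe.map not) (trans (alternates vu) (sym (alternates vx))))

    -- In a complete component `closes` carries a neighbour of one end across `uv` to the other. The
    -- assumption may sit at `u` or at `y`, since an edge transports `nothing`.
    twins : ∀ {y} → y ≢ u → y ≢ v → kind u ≡ nothing ⊎ kind y ≡ nothing → adj G u y ≡ adj G v y
    twins y≢u y≢v p = T-ext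
      (λ uy → closes (at-u p uy) vu uy (≢-sym y≢v))
      (λ vy → closes (at-v p vy) uv vy (≢-sym y≢u))
      where
      at-u : ∀ {y} → kind u ≡ nothing ⊎ kind y ≡ nothing → Edge G u y → kind u ≡ nothing
      at-u (inj₁ p) _  = p
      at-u (inj₂ p) uy = nothing⁺ (flip G uy) p
      at-v : ∀ {y} → kind u ≡ nothing ⊎ kind y ≡ nothing → Edge G v y → kind v ≡ nothing
      at-v (inj₁ p) _  = nothing⁺ uv p
      at-v (inj₂ p) vy = nothing⁺ (flip G vy) p

    unchanged : ∀ x y → kind x ≡ nothing ⊎ kind y ≡ nothing → adj G∧uv x y ≡ adj G x y
    unchanged = pairs _
      (λ {x} {y} P p → trans (adj-sym G∧uv y x) (trans (P (swap p)) (adj-sym G x y)))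
      (λ x _ → trans (adj-irrefl G∧uv x) (sym (adj-irrefl G x)))
      (λ _ → trans (pivot-ends G uv) (sym (⇒ T-≡ uv)))
      (λ y≢u y≢v p → trans (pivot-first G uv y≢u y≢v) (sym (twins y≢u y≢v p)))
      (λ y≢u y≢v p → trans (pivot-second G uv y≢u y≢v) (twins y≢u y≢v (map₁ (nothing⁺ vu) p)))
      λ {x} {y} x≢u x≢v y≢u y≢v x≢y p →
        trans (pivot-rest G uv x≢u x≢v y≢u y≢v x≢y) (cancels x≢u x≢v y≢u y≢v p)
      where

      -- Only one of `x`, `y` is known to have kind `nothing`. If it is adjacent to `u`, both are
      -- twins for `u` and `v` and the products are equal; if not, it misses `v` too and the
      -- products vanish.
      cancel : ∀ a {p q r s} → (T r → p ≡ q) → r ≡ s → a xor ((p ∧ s) xor (q ∧ r)) ≡ a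
      cancel a {p} {q} {false} _   refl rewrite ∧-zeroʳ p | ∧-zeroʳ q = Bool.xor-identityʳ a
      cancel a {p} {q} {true}  p≡q refl rewrite p≡q _ | xor-same (q ∧ true) = Bool.xor-identityʳ a

      cancel′ : ∀ a {p q r s} → p ≡ q → (T p → r ≡ s) → a xor ((p ∧ s) xor (q ∧ r)) ≡ a
      cancel′ a {false}         refl _   = Bool.xor-identityʳ a
      cancel′ a {true}  {s = s} refl r≡s rewrite r≡s _ | xor-same s = Bool.xor-identityʳ a

      cancels : ∀ {x y} → x ≢ u → x ≢ v → y ≢ u → y ≢ v → kind x ≡ nothing ⊎ kind y ≡ nothing →
        adj G x y xor ((adj G u x ∧ adj G v y) xor (adj G v x ∧ adj G u y)) ≡ adj G x y
      cancels {x} {y} x≢u x≢v y≢u y≢v (inj₂ p) = cancel (adj G x y)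
        (λ uy → twins x≢u x≢v (inj₁ (nothing⁺ (flip G uy) p))) (twins y≢u y≢v (inj₂ p))
      cancels {x} {y} x≢u x≢v y≢u y≢v (inj₁ p) = cancel′ (adj G x y)
        (twins x≢u x≢v (inj₂ p)) (λ ux → twins y≢u y≢v (inj₁ (nothing⁺ (flip G ux) p)))

    closes′ : ∀ {x y z} → kind′ y ≡ nothing → Edge G∧uv x y → Edge G∧uv y z → x ≢ z → Edge G∧uv x z
    closes′ {x} {y} {z} p xy yz x≢z =
      subst T (sym (unchanged x z (inj₁ (nothing⁺ (flip G xy′) y-nothing)))) (closes y-nothing xy′ yz′ x≢z)
      where
      y-nothing = kind′-nothing p
      xy′ = subst T (unchanged x y (inj₂ y-nothing)) xy
      yz′ = subst T (unchanged y z (inj₁ y-nothing)) yz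

  Classified-pivot : Classified (pivot G u v)
  Classified-pivot = classified kind′ (alternates′ _ _) closes′

Classified-minor : ∀ {n m} {G : Graph n} {G′ : Graph m} →
  Star _⟶_ (_ , G) (_ , G′) → Classified G → Classified G′
Classified-minor ε                            = id
Classified-minor (delete G v ◅ steps)         = Classified-minor steps ∘ Classified-↪ (deleteVertex-↪ G v)
Classified-minor (pivotEdge G u v uv ◅ steps) = λ class → Classified-minor steps (Classified-pivot class uv)

-- Alternating kinds around a triangle forces `nothing`; `closes` at `2F` would then join `0F` to
-- the pendant `3F`.
paw-unclassified : ¬ Classified paw
paw-unclassified (classified kind alternates closes) =
  closes {0F} {2F} {3F} (trans (alternates {0F} {2F} _) (cong (Maybe.map not) kind-0)) _ _ λ ()
  where
  fixed : ∀ {a} → Maybe.map not a ≡ Maybe.map not (Maybe.map not a) → a ≡ nothing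
  fixed {nothing}     _  = refl
  fixed {just false} ()
  fixed {just true}  ()

  kind-0 : kind 0F ≡ nothing
  kind-0 = fixed (trans (sym (alternates {0F} {2F} _))
    (trans (alternates {1F} {2F} _) (cong (Maybe.map not) (alternates {0F} {1F} _))))

Classified⇒paw-free : ∀ {n} {G : Graph n} → Classified G → PivotMinorFree paw G
Classified⇒paw-free class = PivotMinorFree⇐ λ (_ , _ , steps , f) →
  paw-unclassified (Classified-↪ f (Classified-minor steps class))

-- From the local form to components.

BipartiteOrCompleteComponents : ∀ {n} → Graph n → Set
BipartiteOrCompleteComponents {n} G =
  ∀ m (s : Fin m ↣ Fin n) → IsComponent G s → Bipartite (G [ s ]) ⊎ Complete (G [ s ])

NoInducedObstruction : ∀ {n} → Graph n → Set
NoInducedObstruction G = (¬ HasInduced paw G) × (¬ HasInduced diamond G)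
  × (∀ k → 5 ≤ k → 2 ∤ k → ¬ HasInduced (cycle k) G)

Classified⇒components : ∀ {n} (G : Graph n) → Classified G → BipartiteOrCompleteComponents G
Classified⇒components {n} G (classified kind alternates closes) m s (v , component) =
  decide (kind v) refl
  where
  open Injection s using () renaming (to to vertex; injective to vertex-injective)

  from-root : ∀ i → Connected G v (vertex i)
  from-root i = ⇒ (component (vertex i)) (i , refl)

  spread-nothing : ∀ {x y} → Connected G x y → kind x ≡ nothing → kind y ≡ nothing
  spread-nothing ε        p = p
  spread-nothing (xy ◅ w) p = spread-nothing w (trans (alternates xy) (cong (Maybe.map not) p))

  spread-just : ∀ {x y b} → Connected G x y → kind x ≡ just b → ∃ λ c → kind y ≡ just c
  spread-just ε        p = _ , p
  spread-just (xy ◅ w) p = spread-just w (trans (alternates xy) (cong (Maybe.map not) p))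

  equal-or-adjacent : ∀ {x y} → Connected G x y → kind x ≡ nothing → x ≡ y ⊎ Edge G x y
  equal-or-adjacent ε _ = inj₁ refl
  -- The walk is contracted from its far end: the rest is at most one edge, and `closes` merges it
  -- with the first edge.
  equal-or-adjacent {x} {y} (xz ◅ w) p with nothing-z ← trans (alternates xz) (cong (Maybe.map not) p)
    with equal-or-adjacent w nothing-z | x ≟ y
  ... | _         | yes x≡y = inj₁ x≡y
  ... | inj₁ refl | no _    = inj₂ xz
  ... | inj₂ zy   | no x≢y  = inj₂ (closes nothing-z xz zy x≢y)

  decide : ∀ a → kind v ≡ a → Bipartite (G [ s ]) ⊎ Complete (G [ s ])
  decide nothing p = inj₂ complete
    where
    complete : Complete (G [ s ])
    complete i j i≢j with equal-or-adjacent (reverse (flip G) (from-root i) ◅◅ from-root j)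
                                            (spread-nothing (from-root i) p)
    ... | inj₁ same = contradiction (vertex-injective same) i≢j
    ... | inj₂ ij   = ij
  decide (just b) p = inj₁ (fromMaybe b ∘ kind ∘ vertex , opposite)
    where
    opposite : ∀ i j → Edge G (vertex i) (vertex j) →
      fromMaybe b (kind (vertex i)) ≢ fromMaybe b (kind (vertex j))
    opposite i j ij with spread-just (from-root i) p
    ... | c , q rewrite alternates ij | q = not-¬ refl

-- Components

enumerate : ∀ {n} {P : Fin n → Set} → (∀ x → Dec (P x)) →
  ∃ λ m → Σ (Fin m ↣ Fin n) λ s → ∀ x → (∃ λ i → Injection.to s i ≡ x) ⇔ P x
enumerate {zero}  P? = 0 , mk↣ {to = id} id , λ ()
enumerate {suc n} {P} P? with enumerate (P? ∘ suc) | P? zero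
... | m , s , image | no ¬P₀ = m , mk↣ (Injection.injective s ∘ suc-injective) , image′
  where
  image′ : ∀ x → (∃ λ i → suc (Injection.to s i) ≡ x) ⇔ P x
  image′ zero    = mk⇔ (λ ()) λ p → contradiction p ¬P₀
  image′ (suc x) = mk⇔ (λ (i , p) → ⇒ (image x) (i , suc-injective p))
                       (λ p → let i , q = ⇐ (image x) p in i , cong suc q)
... | m , s , image | yes P₀ = suc m , mk↣ {to = to′} injective′ , image′
  where
  to′ : Fin (suc m) → Fin (suc n)
  to′ zero    = zero
  to′ (suc i) = suc (Injection.to s i)

  injective′ : ∀ {i j} → to′ i ≡ to′ j → i ≡ j
  injective′ {zero}  {zero}  _ = refl
  injective′ {suc i} {suc j} p = cong suc (Injection.injective s (suc-injective p))

  image′ : ∀ x → (∃ λ i → to′ i ≡ x) ⇔ P x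
  image′ zero    = mk⇔ (λ _ → P₀) λ _ → zero , refl
  image′ (suc x) = mk⇔ (λ { (zero , ()) ; (suc i , p) → ⇒ (image x) (i , suc-injective p) })
                       (λ p → let i , q = ⇐ (image x) p in suc i , cong suc q)

-- Connectivity is not decided. Excluded middle at each of the finitely many vertices holds under
-- double negation, which is enough for refuting an induced subgraph.
component-of : ∀ {n} (G : Graph n) v →
  ¬ ¬ (∃ λ m → Σ (Fin m ↣ Fin n) λ s → ∀ x → (∃ λ i → Injection.to s i ≡ x) ⇔ Connected G v x)
component-of G v none =
  sequence (RawMonad.rawApplicative ¬¬-Monad) {P = Dec ∘ Connected G v}
    (λ x → ¬¬-excluded-middle) (none ∘ enumerate)

Bipartite-↪ : ∀ {m n} (H : Graph m) (G : Graph n) → H ↪ G → Bipartite G → Bipartite H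
Bipartite-↪ H G f (side , opposite) = side ∘ to f , λ x y xy → opposite (to f x) (to f y) (Edge⁺ f xy)

Complete-↪ : ∀ {m n} (H : Graph m) (G : Graph n) → H ↪ G → Complete G → Complete H
Complete-↪ H G f complete x y x≢y = Edge⁻ f (complete (to f x) (to f y) (x≢y ∘ injective f))

-- Walks of `H` map to walks of `G`, so the whole image of `H` lies in the component of `to f r`;
-- bipartiteness and completeness would both pass down to `H`.
connected-avoided : ∀ {k n} (H : Graph k) (G : Graph n) r → (∀ x → Connected H r x) →
  ¬ Bipartite H → ¬ Complete H →
  BipartiteOrCompleteComponents G → ¬ HasInduced H G
connected-avoided H G r connected ¬bipartite ¬complete components induced =
  component-of G (to f r) λ (m , s , component) → avoid s component (components m s (_ , component))
  where
  f = HasInduced⇒↪ {H = H} {G} induced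

  module _ {m} (s : Fin m ↣ Fin _)
           (component : ∀ x → (∃ λ i → Injection.to s i ≡ x) ⇔ Connected G (to f r) x) where
    index : ∀ x → ∃ λ i → Injection.to s i ≡ to f x
    index x = ⇐ (component (to f x)) (gmap (to f) (Edge⁺ f) (connected x))

    g : H ↪ (G [ s ])
    g = embedding (proj₁ ∘ index)
      (λ {x} {y} p → injective f (trans (sym (proj₂ (index x)))
        (trans (cong (Injection.to s) p) (proj₂ (index y)))))
      λ x y → trans (preserves f x y) (sym (cong₂ (adj G) (proj₂ (index x)) (proj₂ (index y))))

    avoid : Bipartite (G [ s ]) ⊎ Complete (G [ s ]) → ⊥
    avoid (inj₁ bipartite) = ¬bipartite (Bipartite-↪ H (G [ s ]) g bipartite)
    avoid (inj₂ complete)  = ¬complete (Complete-↪ H (G [ s ]) g complete)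

triangle-not-bipartite : ∀ {n} (G : Graph n) x y z → Edge G x y → Edge G y z → Edge G x z → ¬ Bipartite G
triangle-not-bipartite G x y z xy yz xz (side , opposite) =
  pigeonhole (opposite x y xy) (opposite y z yz) (opposite x z xz)
  where
  pigeonhole : ∀ {a b c : Bool} → a ≢ b → b ≢ c → a ≢ c → ⊥
  pigeonhole {false} {false} a≢b _ _ = a≢b refl
  pigeonhole {true}  {true}  a≢b _ _ = a≢b refl
  pigeonhole {false} {true} {false} _ _ a≢c = a≢c refl
  pigeonhole {false} {true} {true}  _ b≢c _ = b≢c refl
  pigeonhole {true} {false} {false} _ b≢c _ = b≢c refl
  pigeonhole {true} {false} {true}  _ _ a≢c = a≢c refl

paw-connected : ∀ x → Connected paw 2F x
paw-connected 0F = _ ◅ ε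
paw-connected 1F = _ ◅ ε
paw-connected 2F = ε
paw-connected 3F = _ ◅ ε

diamond-connected : ∀ x → Connected diamond 2F x
diamond-connected 0F = _ ◅ ε
diamond-connected 1F = _ ◅ ε
diamond-connected 2F = ε
diamond-connected 3F = _ ◅ ε

-- Odd cycles

-- Boolean parity adds by `xor`, like the colours it is compared with.
odd : ℕ → Bool
odd zero    = false
odd (suc n) = not (odd n)

odd-+ : ∀ m n → odd (m + n) ≡ odd m xor odd n
odd-+ zero    n = refl
odd-+ (suc m) n = trans (cong not (odd-+ m n)) (Bool.not-distribˡ-xor (odd m) (odd n))

even⇒2∣ : ∀ n → odd n ≡ false → 2 ∣ n
even⇒2∣ zero          _ = divides 0 refl
even⇒2∣ (suc (suc n)) p =
  ∣m∣n⇒∣m+n ∣-refl (even⇒2∣ n (trans (sym (Bool.not-involutive (odd n))) p))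

odd⇒2∤ : ∀ n → odd n ≡ true → 2 ∤ n
odd⇒2∤ _ p (divides q refl) = contradiction (trans (sym (even q)) p) λ ()
  where
  even : ∀ q → odd (q ℕ.* 2) ≡ false
  even zero    = refl
  even (suc q) = trans (Bool.not-involutive (odd (q ℕ.* 2))) (even q)

Next : (k : ℕ) → ℕ → ℕ → Set
Next k i j = suc i ≡ j ⊎ (suc i ≡ k × j ≡ 0)

module _ {k} (i j : Fin k) where
  private
    next : ∀ i j → T ((suc i ≡ᵇ j) ∨ ((suc i ≡ᵇ k) ∧ (j ≡ᵇ 0))) → Next k i j
    next i j t with ⇒ T-∨ t
    ... | inj₁ p = inj₁ (ℕ.≡ᵇ⇒≡ (suc i) j p)
    ... | inj₂ p with ⇒ T-∧ p
    ...   | q , r = inj₂ (ℕ.≡ᵇ⇒≡ (suc i) k q , ℕ.≡ᵇ⇒≡ j 0 r)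

    next⁻¹ : ∀ i j → Next k i j → T ((suc i ≡ᵇ j) ∨ ((suc i ≡ᵇ k) ∧ (j ≡ᵇ 0)))
    next⁻¹ i j (inj₁ p)       = ⇐ T-∨ (inj₁ (ℕ.≡⇒≡ᵇ (suc i) j p))
    next⁻¹ i j (inj₂ (p , q)) = ⇐ (T-∨ {suc i ≡ᵇ j})
      (inj₂ (⇐ T-∧ (ℕ.≡⇒≡ᵇ (suc i) k p , ℕ.≡⇒≡ᵇ j 0 q)))

  cycle-edge⁻ : Edge (cycle k) i j → Next k (toℕ i) (toℕ j) ⊎ Next k (toℕ j) (toℕ i)
  cycle-edge⁻ e with ⇒ T-∨ (proj₂ (⇒ (T-∧ {distinct i j}) e))
  ... | inj₁ p = inj₁ (next (toℕ i) (toℕ j) p)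
  ... | inj₂ p = inj₂ (next (toℕ j) (toℕ i) p)

  cycle-edge⁺ : i ≢ j → Next k (toℕ i) (toℕ j) → Edge (cycle k) i j
  cycle-edge⁺ i≢j p = ⇐ T-∧ (⇐ T-≡ (≢⇒distinct i≢j) , ⇐ T-∨ (inj₁ (next⁻¹ (toℕ i) (toℕ j) p)))

module _ (k : ℕ) where
  private
    C = cycle (suc (suc k))

  cycle-step : ∀ i → Edge C (inject₁ i) (suc i)
  cycle-step i = cycle-edge⁺ (inject₁ i) (suc i)
    (λ p → ℕ.1+n≢n (trans (cong toℕ (sym p)) (toℕ-inject₁ i)))
    (inj₁ (cong suc (toℕ-inject₁ i)))

  cycle-connected : ∀ i → Connected C zero i
  cycle-connected = <-weakInduction (Connected C zero) ε λ i w → w ◅◅ cycle-step i ◅ ε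

  -- Along the path the side of a vertex is governed by the parity of its index. The last index
  -- `suc k` is even, so the closing edge joins equal sides.
  odd-cycle-not-bipartite : odd k ≡ true → ¬ Bipartite C
  odd-cycle-not-bipartite p (side , opposite) = opposite (fromℕ (suc k)) zero closing
    (trans (alternating (fromℕ (suc k)))
      (cong (_xor side zero) (trans (cong odd (toℕ-fromℕ (suc k))) (cong not p))))
    where
    alternating : ∀ i → side i ≡ odd (toℕ i) xor side zero
    alternating = <-weakInduction _ refl λ i q → begin
      side (suc i)                               ≡⟨ Bool.¬-not (≢-sym (opposite _ _ (cycle-step i))) ⟩
      not (side (inject₁ i))                     ≡⟨ cong not q ⟩
      not (odd (toℕ (inject₁ i)) xor side zero)  ≡⟨ cong (λ m → not (odd m xor side zero)) (toℕ-inject₁ i) ⟩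
      not (odd (toℕ i) xor side zero)            ≡⟨ Bool.not-distribˡ-xor (odd (toℕ i)) (side zero) ⟩
      odd (suc (toℕ i)) xor side zero            ∎
      where open ≡-Reasoning

    closing : Edge C (fromℕ (suc k)) zero
    closing = cycle-edge⁺ (fromℕ (suc k)) zero (λ ()) (inj₂ (cong suc (toℕ-fromℕ (suc k)) , refl))

components⇒no-induced : ∀ {n} (G : Graph n) → BipartiteOrCompleteComponents G → NoInducedObstruction G
components⇒no-induced G components =
  connected-avoided paw G 2F paw-connected (triangle-not-bipartite paw 0F 1F 2F _ _ _)
    (λ complete → complete 0F 3F λ ()) components ,
  connected-avoided diamond G 2F diamond-connected (triangle-not-bipartite diamond 0F 1F 2F _ _ _)
    (λ complete → complete 0F 3F λ ()) components ,
  no-cycle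
  where
  no-cycle : ∀ k → 5 ≤ k → 2 ∤ k → ¬ HasInduced (cycle k) G
  no-cycle (suc (suc (suc (suc (suc k))))) (s≤s (s≤s (s≤s (s≤s (s≤s z≤n))))) 2∤k =
    connected-avoided (cycle (5 + k)) G 0F (cycle-connected (3 + k))
      -- The lemma counts the length minus two, which has the same parity.
      (odd-cycle-not-bipartite (3 + k) (trans (sym (Bool.not-involutive (odd (3 + k))))
        (Bool.¬-not (2∤k ∘ even⇒2∣ (5 + k)))))
      (λ complete → complete 0F 2F λ ()) components

paw-free⇒no-induced : ∀ {n} (G : Graph n) → PivotMinorFree paw G → NoInducedObstruction G
paw-free⇒no-induced G free = ¬minor ∘ induced {H = paw} ,
  ¬minor ∘ minor-pivot {H = diamond} 1F 0F _ paw↪pivot-diamond ∘ induced {H = diamond} , no-cycle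
  where
  ¬minor = PivotMinorFree⇒ {H = paw} {G} free
  induced : ∀ {k} {H : Graph k} → HasInduced H G → H PivotMinorOf G
  induced {H = H} h = _ , G , ε , HasInduced⇒↪ {H = H} {G} h
  no-cycle : ∀ k → 5 ≤ k → 2 ∤ k → ¬ HasInduced (cycle k) G
  no-cycle (suc (suc (suc (suc (suc k))))) (s≤s (s≤s (s≤s (s≤s (s≤s z≤n))))) 2∤k =
    ¬minor ∘ paw-minor-cycle k 2∤k ∘ induced {H = cycle (5 + k)}

-- Two-colourings and odd closed walks

-- R x y p asks that y differ from x by p.  Vertex zero is eliminated by composing
-- the constraints through it; W plays the role of the walks composed from R.
two-colouring : ∀ {n} (R W : Fin n → Fin n → Bool → Set) → (∀ x y p → Dec (R x y p)) →
  (∀ {x y p} → R x y p → R y x p) → (∀ {x y p} → R x y p → W x y p) →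
  (∀ {x y z p q} → W x y p → W y z q → W x z (p xor q)) → (∀ {x} → ¬ W x x true) →
  ∃ λ (c : Fin n → Bool) → ∀ {x y p} → R x y p → c y ≡ p xor c x
two-colouring {zero}  R W R? R-sym R⊆W W-trans ¬W = (λ ()) , λ { {()} }
two-colouring {suc n} R W R? R-sym R⊆W W-trans ¬W = extend (any? λ x → R₀? x)
  where
  -- Here `q` is the parity of the leg into `zero`, so the other leg must have parity `q xor p`.
  -- Listing both values of `q` keeps `R′` decidable.
  Via : Fin n → Fin n → Bool → Bool → Set
  Via x y p q = R (suc x) zero q × R zero (suc y) (q xor p)

  R′ : Fin n → Fin n → Bool → Set
  R′ x y p = R (suc x) (suc y) p ⊎ Via x y p false ⊎ Via x y p true

  R₀? : ∀ x → Dec (R (suc x) zero false ⊎ R (suc x) zero true)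
  R₀? x = R? (suc x) zero false ⊎-dec R? (suc x) zero true

  via : ∀ {x y p q} → R (suc x) zero q → R zero (suc y) p → R′ x y (q xor p)
  via {q = false} xz zy = inj₂ (inj₁ (xz , zy))
  via {p = p} {q = true} xz zy = inj₂ (inj₂ (xz , subst (R zero _) (sym (Bool.not-involutive p)) zy))

  R′-sym : ∀ {x y p} → R′ x y p → R′ y x p
  R′-sym             (inj₁ xy)               = inj₁ (R-sym xy)
  R′-sym {p = p}     (inj₂ (inj₁ (xz , zy))) =
    subst (R′ _ _) (Bool.xor-identityʳ p) (via (R-sym zy) (R-sym xz))
  R′-sym {p = false} (inj₂ (inj₂ (xz , zy))) = via (R-sym zy) (R-sym xz)
  R′-sym {p = true}  (inj₂ (inj₂ (xz , zy))) = via (R-sym zy) (R-sym xz)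

  R′⊆W : ∀ {x y p} → R′ x y p → W (suc x) (suc y) p
  R′⊆W         (inj₁ xy)               = R⊆W xy
  R′⊆W         (inj₂ (inj₁ (xz , zy))) = W-trans (R⊆W xz) (R⊆W zy)
  R′⊆W {p = p} (inj₂ (inj₂ (xz , zy))) =
    subst (W _ _) (Bool.not-involutive p) (W-trans (R⊆W xz) (R⊆W zy))

  rest : ∃ λ (c : Fin n → Bool) → ∀ {x y p} → R′ x y p → c y ≡ p xor c x
  rest = two-colouring R′ (λ x y → W (suc x) (suc y))
    (λ x y p → R? _ _ _ ⊎-dec (R? _ _ _ ×-dec R? _ _ _) ⊎-dec (R? _ _ _ ×-dec R? _ _ _))
    R′-sym R′⊆W W-trans ¬W
  c = proj₁ rest
  c-respects : ∀ {x y p} → R′ x y p → c y ≡ p xor c x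
  c-respects = proj₂ rest

  Respected : Bool → Set
  Respected b = ∀ {x p} → R (suc x) zero p → b ≡ p xor c x

  xor-swap : ∀ p {a b} → a ≡ p xor b → b ≡ p xor a
  xor-swap false refl = refl
  xor-swap true  refl = sym (Bool.not-involutive _)

  colouring : ∀ b → Respected b → ∃ λ (c : Fin (suc n) → Bool) → ∀ {x y p} → R x y p → c y ≡ p xor c x
  colouring b respected = c⁺ , c⁺-respects
    where
    c⁺ : Fin (suc n) → Bool
    c⁺ zero    = b
    c⁺ (suc x) = c x

    c⁺-respects : ∀ {x y p} → R x y p → c⁺ y ≡ p xor c⁺ x
    c⁺-respects {zero}  {zero}  {false} _ = refl
    c⁺-respects {zero}  {zero}  {true}  r = contradiction (R⊆W r) ¬W
    c⁺-respects {zero}  {suc y} {p}     r = xor-swap p (respected (R-sym r))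
    c⁺-respects {suc x} {zero}  {p}     r = respected r
    c⁺-respects {suc x} {suc y} {p}     r = c-respects (inj₁ r)

  -- One neighbour of `zero` determines its colour; every other neighbour agrees, being constrained
  -- against the first by `R′` through `zero`.
  forced : ∀ {x₀ q} → R (suc x₀) zero q → Respected (q xor c x₀)
  forced {x₀} {q} r₀ {x} {p} r =
    xor-swap p (trans (c-respects (via r₀ (R-sym r))) (reassociate q p (c x₀)))
    where
    reassociate : ∀ q p a → (q xor p) xor a ≡ p xor (q xor a)
    reassociate false p     a = refl
    reassociate true  false a = refl
    reassociate true  true  a = sym (Bool.not-involutive a)

  unforced : ¬ (∃ λ x → R (suc x) zero false ⊎ R (suc x) zero true) → Respected false
  unforced none {p = false} r = contradiction (_ , inj₁ r) none
  unforced none {p = true}  r = contradiction (_ , inj₂ r) none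

  extend : Dec (∃ λ x → R (suc x) zero false ⊎ R (suc x) zero true) →
    ∃ λ (c : Fin (suc n) → Bool) → ∀ {x y p} → R x y p → c y ≡ p xor c x
  extend (yes (_ , inj₁ r)) = colouring _ (forced r)
  extend (yes (_ , inj₂ r)) = colouring _ (forced r)
  extend (no none)          = colouring false (unforced none)

infixr 5 _∷_

data Walk {n} (G : Graph n) : ℕ → Fin n → Fin n → Set where
  []  : ∀ {x} → Walk G 0 x x
  _∷_ : ∀ {k x y z} → Edge G x y → Walk G k y z → Walk G (suc k) x z

-- The two closed walks through a shortcut of length d have total length k + 2 d.
split-odd : ∀ i b c d → (i xor b) xor c ≡ true → b xor d ≡ true ⊎ d xor (c xor i) ≡ true
split-odd i false c true  _ = inj₁ refl
split-odd i true  c false _ = inj₁ refl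
split-odd i false c false p =
  inj₂ (trans (solve 2 (λ i c → con false :+ (c :+ i) := (i :+ con false) :+ c) refl i c) p)
  where open xor-∧-Solver
split-odd i true  c true  p =
  inj₂ (trans (solve 2 (λ i c → con true :+ (c :+ i) := (i :+ con true) :+ c) refl i c) p)
  where open xor-∧-Solver

module _ {n} {G : Graph n} where
  infixr 5 _++_

  _++_ : ∀ {k l x y z} → Walk G k x y → Walk G l y z → Walk G (k + l) x z
  []      ++ w′ = w′
  (e ∷ w) ++ w′ = e ∷ w ++ w′

  -- Constant after the end of the walk.
  vertex : ∀ {k x y} → ℕ → Walk G k x y → Fin n
  vertex {x = x} zero    _       = x
  vertex {x = x} (suc i) []      = x
  vertex         (suc i) (_ ∷ w) = vertex i w

  vertex-end : ∀ {k x y} (w : Walk G k x y) → vertex k w ≡ y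
  vertex-end []      = refl
  vertex-end (_ ∷ w) = vertex-end w

  step : ∀ {k x y} (w : Walk G k x y) i → i < k → Edge G (vertex i w) (vertex (suc i) w)
  step (e ∷ w) zero    _         = e
  step (e ∷ w) (suc i) (s<s i<k) = step w i i<k

  segment : ∀ {k x y} (w : Walk G k x y) i d → i + d ≤ k → Walk G d (vertex i w) (vertex (i + d) w)
  segment w       zero    zero    _       = []
  segment (e ∷ w) zero    (suc d) (s≤s p) = e ∷ segment w zero d p
  segment (e ∷ w) (suc i) d       (s≤s p) = segment w i d p

  -- The vertices at `i` and `j` cut the closed walk into two arcs. Completing each with the
  -- shortcut gives two closed walks, one of them odd; the inequalities say that the shortcut is
  -- shorter than either arc.
  shortcut : ∀ {k x} (w : Walk G k x x) {i j d} → odd k ≡ true →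
    i + d < j → j + d < k + i → j ≤ k →
    Walk G d (vertex i w) (vertex j w) → Walk G d (vertex j w) (vertex i w) →
    ∃ λ l → l < k × odd l ≡ true × Walk G l (vertex i w) (vertex i w)
  shortcut {k} {x} w {i} {j} {d} odd-k i+d<j j+d<k+i j≤k there back
    -- The arcs have lengths `b` and `c + i`, where `c` counts the steps from position `j` to the
    -- end.
    with b , refl ← ℕ.m≤n⇒∃[o]m+o≡n (ℕ.≤-trans (ℕ.m≤m+n i d) (ℕ.<⇒≤ i+d<j))
    with c , refl ← ℕ.m≤n⇒∃[o]m+o≡n j≤k
    with split-odd (odd i) (odd b) (odd c) (odd d)
           (trans (sym (trans (odd-+ (i + b) c) (cong (_xor odd c) (odd-+ i b)))) odd-k)
  ... | inj₁ p = b + d , b+d<k , trans (odd-+ b d) p , segment w i b j≤k ++ back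
    where
    b+d<k : b + d < i + b + c
    b+d<k = ℕ.+-cancelˡ-< i _ _ (subst₂ _<_ (ℕ.+-assoc i b d) (ℕ.+-comm (i + b + c) i) j+d<k+i)
  ... | inj₂ p = d + (c + i) , shorter ,
      trans (trans (odd-+ d (c + i)) (cong (odd d xor_) (odd-+ c i))) p ,
      -- The second arc passes through the base point, where the end of `w` meets its start.
      there ++ subst (Walk G c _) (vertex-end w) (segment w (i + b) c ℕ.≤-refl)
            ++ segment w 0 i (ℕ.≤-trans (ℕ.m≤m+n i b) (ℕ.m≤m+n (i + b) c))
    where
    shorter : d + (c + i) < i + b + c
    shorter = subst (d + (c + i) <_)
      (trans (sym (ℕ.+-assoc b c i)) (trans (ℕ.+-comm (b + c) i) (sym (ℕ.+-assoc i b c))))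
      (ℕ.+-monoˡ-< (c + i) (ℕ.+-cancelˡ-< i d b i+d<j))

  -- A repeated vertex is a shortcut of length 0 and a chord one of length 1. Minimality is assumed
  -- at every position because `shortcut` moves the base point.
  shortest-odd-walk-induced : ∀ {k x} (w : Walk G (suc (suc k)) x x) → odd (suc (suc k)) ≡ true →
    (∀ i {l} → l < suc (suc k) → odd l ≡ true → ¬ Walk G l (vertex i w) (vertex i w)) →
    cycle (suc (suc k)) ↪ G
  shortest-odd-walk-induced {k′} w odd-k shortest =
    ↪-fromIncreasing f separates λ i<j → T-ext (edge⁺ i<j) (edge⁻ i<j)
    where
    k = suc (suc k′)

    f : Fin k → Fin n
    f i = vertex (toℕ i) w

    chordless : ∀ {i j d} → toℕ i + d < toℕ j → toℕ j + d < k + toℕ i →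
      Walk G d (f i) (f j) → Walk G d (f j) (f i) → ⊥
    chordless {i} {j} p q there back =
      let l , l<k , odd-l , closed = shortcut w odd-k p q (ℕ.<⇒≤ (toℕ<n j)) there back
      in shortest (toℕ i) l<k odd-l closed

    separates : ∀ {i j} → i Fin.< j → f i ≢ f j
    separates {i} {j} i<j fi≡fj = chordless {i} {j} {0}
      (subst (_< toℕ j) (sym (ℕ.+-identityʳ (toℕ i))) i<j)
      (subst (_< k + toℕ i) (sym (ℕ.+-identityʳ (toℕ j))) (ℕ.<-≤-trans (toℕ<n j) (ℕ.m≤m+n k (toℕ i))))
      (subst (Walk G 0 (f i)) fi≡fj []) (subst (λ x → Walk G 0 x (f i)) fi≡fj [])

    edge⁺ : ∀ {i j} → i Fin.< j → Edge (cycle k) i j → Edge G (f i) (f j)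
    edge⁺ {i} {j} i<j e with cycle-edge⁻ i j e
    ... | inj₁ (inj₁ p)       = subst (λ m → Edge G (f i) (vertex m w)) p (step w (toℕ i) (toℕ<n i))
    ... | inj₁ (inj₂ (_ , p)) = contradiction (subst (toℕ i <_) p i<j) λ ()
    ... | inj₂ (inj₁ p)       = contradiction (ℕ.<-trans i<j (ℕ.≤-reflexive p)) (ℕ.<-irrefl refl)
    ... | inj₂ (inj₂ (p , q)) = flip G (subst (Edge G (f j))
      (trans (cong (λ m → vertex m w) p) (trans (vertex-end w) (cong (λ m → vertex m w) (sym q))))
      (step w (toℕ j) (toℕ<n j)))

    chord : ∀ {i j} → i Fin.< j → Edge G (f i) (f j) → suc (toℕ i) ≢ toℕ j → suc (toℕ j) < k + toℕ i → ⊥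
    chord {i} {j} i<j e p q = chordless {i} {j} {1}
      (subst (_< toℕ j) (ℕ.+-comm 1 (toℕ i)) (ℕ.≤∧≢⇒< i<j p))
      (subst (_< k + toℕ i) (ℕ.+-comm 1 (toℕ j)) q)
      (e ∷ []) (flip G e ∷ [])

    edge⁻ : ∀ {i j} → i Fin.< j → Edge G (f i) (f j) → Edge (cycle k) i j
    -- Unless the positions are consecutive or are the first and the last, both arcs have length at
    -- least two and the edge is a chord.
    edge⁻ {i} {j} i<j e with suc (toℕ i) ℕ.≟ toℕ j | toℕ i ℕ.≟ 0 | suc (toℕ j) ℕ.≟ k
    ... | yes p | _     | _     = cycle-edge⁺ i j (λ { refl → ℕ.<-irrefl refl i<j }) (inj₁ p)
    ... | no _  | yes p | yes q = flip (cycle k) {j} {i}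
      (cycle-edge⁺ j i (λ { refl → ℕ.<-irrefl refl i<j }) (inj₂ (q , p)))
    ... | no p  | no i≢0 | _    = ⊥-elim (chord i<j e p
      (ℕ.≤-<-trans (toℕ<n j) (ℕ.m<m+n k (ℕ.n≢0⇒n>0 i≢0))))
    ... | no p  | yes _ | no q  = ⊥-elim (chord i<j e p
      (ℕ.<-≤-trans (ℕ.≤∧≢⇒< (toℕ<n j) q) (ℕ.m≤m+n k (toℕ i))))

module _ {n} {G : Graph n} (P : Fin n → Set) (spread : ∀ {x y} → Edge G x y → P x → P y)
         (no-triangle : ∀ {x y z} → P x → Edge G x y → Edge G y z → Edge G z x → ⊥)
         (no-cycle : ∀ k → 5 ≤ k → 2 ∤ k → ¬ HasInduced (cycle k) G) where

  private
    spread-vertex : ∀ {k x y} (w : Walk G k x y) → P x → ∀ i → P (vertex i w)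
    spread-vertex _       p zero    = p
    spread-vertex []      p (suc i) = p
    spread-vertex (e ∷ w) p (suc i) = spread-vertex w (spread e p) i

  -- Strong induction on the length: 1 would be a loop and 3 a triangle. From 5 on, shorter odd
  -- walks are excluded at all vertices of the walk, as `P` spreads along it, so the walk would
  -- trace an induced odd cycle.
  no-odd-closed-walk : ∀ {k x} → Acc _<_ k → odd k ≡ true → P x → ¬ Walk G k x x
  no-odd-closed-walk _ _ _ (e ∷ [])          = Edge⇒≢ G e refl
  no-odd-closed-walk _ _ p (e ∷ e′ ∷ e″ ∷ []) = no-triangle p e e′ e″
  no-odd-closed-walk {suc (suc (suc (suc (suc k))))} (acc rec) odd-k p w@(_ ∷ _ ∷ _ ∷ _ ∷ _ ∷ _) =
    no-cycle (5 + k) (ℕ.m≤m+n 5 k) (odd⇒2∤ (5 + k) odd-k)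
      (↪⇒HasInduced {H = cycle (5 + k)} {G} (shortest-odd-walk-induced w odd-k λ i l<k odd-l closed →
        no-odd-closed-walk (rec l<k) odd-l (spread-vertex w p i) closed))

-- Triangles in graphs without induced paws and diamonds

fourVertices : ∀ {n} (H : Graph 4) (G : Graph n) (f : Fin 4 → Fin n) →
  let Agree = λ i j → f i ≢ f j × adj H i j ≡ adj G (f i) (f j) in
  Agree 0F 1F → Agree 0F 2F → Agree 0F 3F → Agree 1F 2F → Agree 1F 3F → Agree 2F 3F → H ↪ G
fourVertices H G f p₀₁ p₀₂ p₀₃ p₁₂ p₁₃ p₂₃ =
  ↪-fromIncreasing f (λ x<y → proj₁ (pair x<y)) (λ x<y → proj₂ (pair x<y))
  where
  pair : ∀ {i j} → i Fin.< j → f i ≢ f j × adj H i j ≡ adj G (f i) (f j)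
  pair {0F} {1F} _ = p₀₁
  pair {0F} {2F} _ = p₀₂
  pair {0F} {3F} _ = p₀₃
  pair {1F} {2F} _ = p₁₂
  pair {1F} {3F} _ = p₁₃
  pair {2F} {3F} _ = p₂₃
  pair {1F} {1F} (s≤s ())
  pair {2F} {1F} (s≤s ())
  pair {3F} {1F} (s≤s ())
  pair {2F} {2F} (s≤s (s≤s ()))
  pair {3F} {2F} (s≤s (s≤s ()))
  pair {3F} {3F} (s≤s (s≤s (s≤s ())))

module _ {n} (G : Graph n) (no-paw : ¬ HasInduced paw G) (no-diamond : ¬ HasInduced diamond G) where
  private
    edge : ∀ {x y} → Edge G x y → x ≢ y × true ≡ adj G x y
    edge e = Edge⇒≢ G e , sym (⇒ T-≡ e)

    non-edge : ∀ {x y} → x ≢ y → ¬ Edge G x y → x ≢ y × false ≡ adj G x y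
    non-edge x≢y ¬e = x≢y , sym (¬T⇒false ¬e)

  -- The triangles `abc` and `acw` share an edge, so without `bw` they induce a diamond.
  diamond-closes : ∀ {a b c w} → Edge G a b → Edge G a c → Edge G b c →
    Edge G a w → Edge G c w → b ≢ w → Edge G b w
  diamond-closes {a} {b} {c} {w} ab ac bc aw cw b≢w with T? (adj G b w)
  ... | yes bw = bw
  ... | no ¬bw = contradiction
    (↪⇒HasInduced {H = diamond} {G} (fourVertices diamond G (lookup (b ∷ a ∷ c ∷ w ∷ []))
      (edge (flip G ab)) (edge bc) (non-edge b≢w ¬bw) (edge ac) (edge aw) (edge cw)))
    no-diamond

  -- If `w` sees neither `b` nor `c`, the four vertices induce a paw centred at `a`; if it sees one,
  -- `diamond-closes` gives the other.
  triangle-absorbs : ∀ {a b c w} → Edge G a b → Edge G a c → Edge G b c →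
    Edge G a w → b ≢ w → c ≢ w → Edge G b w × Edge G c w
  triangle-absorbs {a} {b} {c} {w} ab ac bc aw b≢w c≢w with T? (adj G b w) | T? (adj G c w)
  ... | yes bw | _      = bw , diamond-closes ac ab (flip G bc) aw bw c≢w
  ... | no _   | yes cw = diamond-closes ab ac bc aw cw b≢w , cw
  ... | no ¬bw | no ¬cw = contradiction
    (↪⇒HasInduced {H = paw} {G} (fourVertices paw G (lookup (b ∷ c ∷ a ∷ w ∷ []))
      (edge bc) (edge (flip G ab)) (non-edge b≢w ¬bw) (edge (flip G ac)) (non-edge c≢w ¬cw) (edge aw)))
    no-paw

  InTriangle : Fin n → Set
  InTriangle x = ∃ λ y → ∃ λ z → Edge G x y × Edge G x z × Edge G y z

  inTriangle? : ∀ x → Dec (InTriangle x)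
  inTriangle? x = any? λ y → any? λ z → T? _ ×-dec T? _ ×-dec T? _

  triangle-spreads : ∀ {x y} → Edge G x y → InTriangle x → InTriangle y
  triangle-spreads {x} {y} xy (b , c , xb , xc , bc) with b ≟ y | c ≟ y
  ... | yes refl | _        = x , c , flip G xb , bc , xc
  ... | no _     | yes refl = x , b , flip G xc , flip G bc , xb
  ... | no b≢y   | no c≢y   =
    x , b , flip G xy , flip G (proj₁ (triangle-absorbs xb xc bc xy b≢y c≢y)) , xb

  common-triangle : ∀ {x y} → Edge G y x → InTriangle y → ∃ λ t → Edge G y t × Edge G x t
  common-triangle {x} {y} yx (b , c , yb , yc , bc) with b ≟ x | c ≟ x
  ... | yes refl | _        = c , yc , bc
  ... | no _     | yes refl = b , yb , flip G bc
  ... | no b≢x   | no c≢x   = b , yb , flip G (proj₁ (triangle-absorbs yb yc bc yx b≢x c≢x))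

  -- The edge `xy` lies in a triangle with some `t`. Either `z` is `t`, or `z` is absorbed by that
  -- triangle through `y`.
  triangle-closes : ∀ {x y z} → InTriangle y → Edge G x y → Edge G y z → x ≢ z → Edge G x z
  triangle-closes {x} {y} {z} triangle xy yz x≢z with common-triangle (flip G xy) triangle
  ... | t , yt , xt with t ≟ z
  ...   | yes refl = xt
  ...   | no t≢z   = proj₁ (triangle-absorbs (flip G xy) yt xt yz x≢z t≢z)

-- The classification from the forbidden subgraphs, and the equivalences.

no-induced⇒Classified : ∀ {n} (G : Graph n) → NoInducedObstruction G → Classified G
no-induced⇒Classified {n} G (no-paw , no-diamond , no-cycle) =
  classified kind alternates closes
  where
  Triangle : Fin n → Set
  Triangle = InTriangle G no-paw no-diamond
  triangle? : ∀ x → Dec (Triangle x)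
  triangle? = inTriangle? G no-paw no-diamond
  spreads : ∀ {x y} → Edge G x y → Triangle x → Triangle y
  spreads = triangle-spreads G no-paw no-diamond

  -- Each edge outside the triangle components demands opposite colours. For `W` it is enough to
  -- record that the start is in no triangle, since this spreads along the walk.
  R W : Fin n → Fin n → Bool → Set
  R x y p = p ≡ true × Edge G x y × ¬ Triangle x
  W x y p = ¬ Triangle x × ∃ λ k → odd k ≡ p × Walk G k x y

  two-coloured : ∃ λ (c : Fin n → Bool) → ∀ {x y p} → R x y p → c y ≡ p xor c x
  two-coloured = two-colouring R W
    (λ x y p → (p Bool.≟ true) ×-dec T? _ ×-dec ¬? (triangle? x))
    (λ (p , xy , ¬x) → p , flip G xy , ¬x ∘ spreads (flip G xy))
    (λ (p , xy , ¬x) → ¬x , 1 , sym p , xy ∷ [])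
    (λ { (¬x , k , refl , w) (_ , l , refl , w′) → ¬x , k + l , odd-+ k l , w ++ w′ })
    λ (¬x , k , odd-k , w) → no-odd-closed-walk (¬_ ∘ Triangle) (λ xy ¬x → ¬x ∘ spreads (flip G xy))
      (λ ¬x xy yz zx → ¬x (_ , _ , xy , flip G zx , yz)) no-cycle (<-wellFounded k) odd-k ¬x w

  c = proj₁ two-coloured

  kind : Fin n → Maybe Bool
  -- A complete component on one or two vertices has no triangle and is treated as bipartite.
  kind x with triangle? x
  ... | yes _ = nothing
  ... | no _  = just (c x)

  alternates : ∀ {x y} → Edge G x y → kind y ≡ Maybe.map not (kind x)
  alternates {x} {y} xy with triangle? x | triangle? y
  ... | yes _ | yes _ = refl
  ... | yes t | no ¬t = contradiction (spreads xy t) ¬t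
  ... | no ¬t | yes t = contradiction (spreads (flip G xy) t) ¬t
  ... | no ¬t | no _  = cong just (proj₂ two-coloured (refl , xy , ¬t))

  closes : ∀ {x y z} → kind y ≡ nothing → Edge G x y → Edge G y z → x ≢ z → Edge G x z
  closes {y = y} p with triangle? y
  ... | yes t = triangle-closes G no-paw no-diamond t

proposition5p4 : ∀ (n : ℕ) (G : Graph n) →
    (PivotMinorFree paw G ⇔ PivotMinorFree diamond G)
    × (PivotMinorFree paw G ⇔
    ((¬ HasInduced paw G) × (¬ HasInduced diamond G)
    × (∀ k → 5 ≤ k → 2 ∤ k → ¬ HasInduced (cycle k) G)))
    × (PivotMinorFree paw G ⇔
    (∀ m (s : Fin m ↣ Fin n) → IsComponent G s →
    Bipartite (G [ s ]) ⊎ Complete (G [ s ])))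
proposition5p4 n G =
  mk⇔ (transfer {H = paw} {diamond} (minor-pivot 1F 0F _ paw↪pivot-diamond))
      (transfer {H = diamond} {paw} (minor-pivot 0F 2F _ diamond↪pivot-paw)) ,
  mk⇔ (paw-free⇒no-induced G) (Classified⇒paw-free ∘ no-induced⇒Classified G) ,
  mk⇔ (Classified⇒components G ∘ no-induced⇒Classified G ∘ paw-free⇒no-induced G)
      (Classified⇒paw-free ∘ no-induced⇒Classified G ∘ components⇒no-induced G)
  where
  transfer : ∀ {k l} {H : Graph k} {F : Graph l} → (F PivotMinorOf G → H PivotMinorOf G) →
    PivotMinorFree H G → PivotMinorFree F G
  transfer F⇒H free = PivotMinorFree⇐ (PivotMinorFree⇒ free ∘ F⇒H)
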